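{- There is an infinite $\Pi_1$ set (a subset of $\mathbb{N}$) with no $\Delta_2$ p-cohesive subset.
   Context: $\Pi_1$ and $\Delta_2$ refer to the arithmetical hierarchy of subsets of $\mathbb{N}$. For $X, Y \subseteq \mathbb{N}$, $X \subseteq^* Y$ means that $X \setminus Y$ is finite. A set $C \subseteq \mathbb{N}$ is p-cohesive if it is infinite and for every primitive recursive set $A \subseteq \mathbb{N}$, either $C \subseteq^* A$ or $C \subseteq^* \mathbb{N} \setminus A$. -}

module Defs where

open import Data.Fin using (Fin)
open import Data.Nat using (ℕ; zero; suc; _<_)
import Data.Nat.InfinitelyOften as IO using (Fin; Inf)
open import Data.Product using (∃-syntax; _×_)
open import Data.Sum using (_⊎_)
open import Data.Vec using (Vec; []; _∷_; lookup; head)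
open import Function using (_⇔_)
open import Level using (0ℓ)
open import Relation.Binary.PropositionalEquality using (_≡_)
open import Relation.Nullary using (¬_)
open import Relation.Unary using (Pred; ∁; _∖_)

Subset : Set₁
Subset = Pred ℕ 0ℓ

-- "Finite" is "bounded above", and "infinite" is its negation.  No function
-- producing arbitrarily large members is asked for: in general an infinite Π₁
-- set has no computable one.
Finite Infinite : Subset → Set
Finite   = IO.Fin
Infinite = IO.Inf

infix 4 _⊆*_
_⊆*_ : Subset → Subset → Set
X ⊆* Y = Finite (X ∖ Y)

data PrimRec : ℕ → Set where
  zeroᶠ : ∀ {n} → PrimRec n
  sucᶠ  : PrimRec 1
  projᶠ : ∀ {n} → Fin n → PrimRec n
  compᶠ : ∀ {m n} → PrimRec m → Vec (PrimRec n) m → PrimRec n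
  recᶠ  : ∀ {n} → PrimRec n → PrimRec (suc (suc n)) → PrimRec (suc n)

-- The recursion variable is the first argument; the step function receives
-- the predecessor, then the previous value, then the parameters.
natRec : ∀ {n} → (Vec ℕ n → ℕ) → (Vec ℕ (suc (suc n)) → ℕ) →
         ℕ → Vec ℕ n → ℕ
natRec f g zero    xs = f xs
natRec f g (suc y) xs = g (y ∷ natRec f g y xs ∷ xs)

mutual
  ⟦_⟧ : ∀ {n} → PrimRec n → Vec ℕ n → ℕ
  ⟦ zeroᶠ ⟧      xs       = 0
  ⟦ sucᶠ ⟧       (x ∷ []) = suc x
  ⟦ projᶠ i ⟧    xs       = lookup xs i
  ⟦ compᶠ f gs ⟧ xs       = ⟦ f ⟧ (⟦ gs ⟧* xs)
  ⟦ recᶠ f g ⟧   (y ∷ xs) = natRec ⟦ f ⟧ ⟦ g ⟧ y xs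

  ⟦_⟧* : ∀ {m n} → Vec (PrimRec n) m → Vec ℕ n → Vec ℕ m
  ⟦ [] ⟧*     xs = []
  ⟦ g ∷ gs ⟧* xs = ⟦ g ⟧ xs ∷ ⟦ gs ⟧* xs

data PartRec : ℕ → Set where
  zeroᶠ : ∀ {n} → PartRec n
  sucᶠ  : PartRec 1
  projᶠ : ∀ {n} → Fin n → PartRec n
  compᶠ : ∀ {m n} → PartRec m → Vec (PartRec n) m → PartRec n
  recᶠ  : ∀ {n} → PartRec n → PartRec (suc (suc n)) → PartRec (suc n)
  μᶠ    : ∀ {n} → PartRec (suc n) → PartRec n

-- f [ xs ]⇓ y : the partial function f is defined at xs, with value y.
infix 4 _[_]⇓_
data _[_]⇓_ : ∀ {n} → PartRec n → Vec ℕ n → ℕ → Set where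
  ⇓zero : ∀ {n} {xs : Vec ℕ n} → zeroᶠ [ xs ]⇓ 0
  ⇓suc  : ∀ {x} → sucᶠ [ x ∷ [] ]⇓ suc x
  ⇓proj : ∀ {n} {xs : Vec ℕ n} (i : Fin n) → projᶠ i [ xs ]⇓ lookup xs i
  ⇓comp : ∀ {m n} {f : PartRec m} {gs : Vec (PartRec n) m} {xs y} (ys : Vec ℕ m) →
          (∀ i → lookup gs i [ xs ]⇓ lookup ys i) →
          f [ ys ]⇓ y →
          compᶠ f gs [ xs ]⇓ y
  ⇓rec₀ : ∀ {n} {f : PartRec n} {g xs z} →
          f [ xs ]⇓ z →
          recᶠ f g [ 0 ∷ xs ]⇓ z
  ⇓rec₁ : ∀ {n} {f : PartRec n} {g xs y z w} →
          recᶠ f g [ y ∷ xs ]⇓ z →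
          g [ y ∷ z ∷ xs ]⇓ w →
          recᶠ f g [ suc y ∷ xs ]⇓ w
  ⇓μ    : ∀ {n} {f : PartRec (suc n)} {xs y} →
          f [ y ∷ xs ]⇓ 0 →
          (∀ i → i < y → ∃[ k ] f [ i ∷ xs ]⇓ suc k) →
          μᶠ f [ xs ]⇓ y

-- G is (the graph of) the characteristic function of R.
IsCharacteristic : ∀ {n} → (Vec ℕ n → ℕ → Set) → Pred (Vec ℕ n) 0ℓ → Set
IsCharacteristic G R = ∀ xs → (R xs × G xs 1) ⊎ (¬ R xs × G xs 0)

Computable : ∀ {n} → Pred (Vec ℕ n) 0ℓ → Set
Computable R = ∃[ f ] IsCharacteristic (f [_]⇓_) R

unary : Subset → Pred (Vec ℕ 1) 0ℓ
unary A xs = A (head xs)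

PrimitiveRecursive : Subset → Set
PrimitiveRecursive A =
  ∃[ f ] IsCharacteristic (λ xs y → ⟦ f ⟧ xs ≡ y) (unary A)

mutual
  data IsΣ : ℕ → ∀ {k} → Pred (Vec ℕ k) 0ℓ → Set₁ where
    computable : ∀ {k} {R : Pred (Vec ℕ k) 0ℓ} → Computable R → IsΣ 0 R
    exists     : ∀ {n k} {R : Pred (Vec ℕ k) 0ℓ} (S : Pred (Vec ℕ (suc k)) 0ℓ) →
                 IsΠ n S → (∀ xs → R xs ⇔ (∃[ y ] S (y ∷ xs))) → IsΣ (suc n) R

  data IsΠ : ℕ → ∀ {k} → Pred (Vec ℕ k) 0ℓ → Set₁ where
    computable : ∀ {k} {R : Pred (Vec ℕ k) 0ℓ} → Computable R → IsΠ 0 R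
    forAll     : ∀ {n k} {R : Pred (Vec ℕ k) 0ℓ} (S : Pred (Vec ℕ (suc k)) 0ℓ) →
                 IsΣ n S → (∀ xs → R xs ⇔ (∀ y → S (y ∷ xs))) → IsΠ (suc n) R

Σ-set Π-set Δ-set : ℕ → Subset → Set₁
Σ-set n A = IsΣ n (unary A)
Π-set n A = IsΠ n (unary A)
Δ-set n A = Σ-set n A × Π-set n A

PCohesive : Subset → Set₁
PCohesive C =
  Infinite C × (∀ A → PrimitiveRecursive A → (C ⊆* A) ⊎ (C ⊆* ∁ A))

{-# OPTIONS --safe #-}
-- Read a number as a pair x = ⟨τ, h⟩.  A set C is split by the digits of τ: if
-- C is p-cohesive, every digit is constant on almost all of C.  If C is Σ₂, then
-- C x holds iff ⟨x, y⟩ ∉ W for some y, with W c.e., say W = Wₑ.  Associate with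
-- the requirement (e, p), p = ⟨x₀, y₀⟩, the Π₂ condition
--   p ∉ Wₑ, and ⟨x, y⟩ ∈ Wₑ for all y and all x ≥ x₀ that differ from x₀ in digit e;
-- it holds for some p if C is infinite and p-cohesive.  For fixed e, the
-- requirements (e, p) that hold all give x₀ the same digit e, so some pattern of
-- digits disagrees with each of the first k requirements that hold.  Let c(τ, s)
-- count the steps of progress seen before stage s towards the conditions of the
-- requirements i < length τ whose digit agrees with that of τ, and let A contain
-- ⟨τ, h⟩ iff h is the exact stage at which c(τ, ·) reaches its limit.  This is
-- Π₁, and A is infinite by the patterns above.  Each τ has at most one h, and if
-- requirement i holds, no ⟨τ, h⟩ in A with the digit of x₀ has length τ > i.
-- Hence an infinite p-cohesive Σ₂ set C ⊆ A would be finite.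
-- Excluded middle is used under double negation, finitely often at a time.
module Submission where

open import Defs
open import Data.Empty using (⊥)
open import Data.Fin using (Fin; zero; suc)
open import Data.Fin.Patterns using (0F; 1F; 2F; 3F)
open import Data.Nat hiding (parity)
open import Data.Nat.Properties
open import Data.Product using (∃-syntax; _×_; _,_; proj₁; proj₂)
open import Data.Sum using (_⊎_; inj₁; inj₂)
open import Data.Vec using (Vec; []; _∷_; lookup)
open import Function using (_∘_; id; mk⇔; Equivalence)
open import Relation.Binary.PropositionalEquality
open import Relation.Nullary using (¬_; yes; no; contradiction)
open import Relation.Nullary.Decidable using (¬¬-excluded-middle; decidable-stable)
open import Relation.Unary using (_⊆_)

-- Primitive recursive functions

-- Curried, so that functions such as `_+_` can be named as they stand; `apply` carries them over to
-- vectors.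
Fun : ℕ → Set
Fun zero    = ℕ
Fun (suc n) = ℕ → Fun n

apply : ∀ {n} → Fun n → Vec ℕ n → ℕ
apply x []       = x
apply f (x ∷ xs) = apply (f x) xs

record PR {n} (F : Vec ℕ n → ℕ) : Set where
  constructor _by_
  field
    code    : PrimRec n
    correct : ∀ xs → ⟦ code ⟧ xs ≡ F xs

open PR

Prim : ∀ n → Fun n → Set
Prim n f = PR {n} (apply f)

-- Indexed by the tuple of functions, so that in `app` the composite function is inferred from the
-- codes and most defining equations hold by `refl`.
data PRs {n} : ∀ {m} → (Vec ℕ n → Vec ℕ m) → Set where
  []  : PRs (λ _ → [])
  _∷_ : ∀ {m F} {Gs : Vec ℕ n → Vec ℕ m} →
        PR F → PRs Gs → PRs (λ xs → F xs ∷ Gs xs)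

codes : ∀ {m n} {Gs : Vec ℕ n → Vec ℕ m} → PRs Gs → Vec (PrimRec n) m
codes []       = []
codes (p ∷ ps) = code p ∷ codes ps

codes-correct : ∀ {m n} {Gs : Vec ℕ n → Vec ℕ m} (ps : PRs Gs) xs →
                ⟦ codes ps ⟧* xs ≡ Gs xs
codes-correct []       xs = refl
codes-correct (p ∷ ps) xs = cong₂ _∷_ (correct p xs) (codes-correct ps xs)

var : ∀ {n} (i : Fin n) → PR (λ xs → lookup xs i)
var i = projᶠ i by λ _ → refl

app : ∀ {m n f} {Gs : Vec ℕ n → Vec ℕ m} →
      Prim m f → PRs Gs → PR (λ xs → apply f (Gs xs))
app {f = f} p ps = compᶠ (code p) (codes ps) by λ xs →
  trans (correct p _) (cong (apply f) (codes-correct ps xs))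

define : ∀ {n F} (f : Fun n) → PR F → (∀ xs → apply f xs ≡ F xs) → Prim n f
define f p eq = code p by λ xs → trans (correct p xs) (sym (eq xs))

recursive : ∀ {n F G} (h : Fun (suc n)) → PR F → PR G →
            (∀ xs → apply (h 0) xs ≡ F xs) →
            (∀ y xs → apply (h (suc y)) xs ≡ G (y ∷ apply (h y) xs ∷ xs)) →
            Prim (suc n) h
recursive {n} {F} {G} h p q base step = recᶠ (code p) (code q) by λ { (y ∷ xs) → go y xs }
  where
  go : ∀ y xs → natRec ⟦ code p ⟧ ⟦ code q ⟧ y xs ≡ apply (h y) xs
  go zero    xs = trans (correct p xs) (sym (base xs))
  go (suc y) xs =
    trans (correct q _) (trans (cong (λ z → G (y ∷ z ∷ xs)) (go y xs)) (sym (step y xs)))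

suc-PR : Prim 1 suc
suc-PR = sucᶠ by λ { (x ∷ []) → refl }

const-PR : ∀ {n} k → PR {n} (λ _ → k)
const-PR zero    = zeroᶠ by λ _ → refl
const-PR (suc k) = app suc-PR (const-PR k ∷ [])

+-PR : Prim 2 _+_
+-PR = recursive _+_ (var 0F) (app suc-PR (var 1F ∷ []))
  (λ { (x ∷ []) → refl }) (λ { y (x ∷ []) → refl })

*-PR : Prim 2 _*_
*-PR = recursive _*_ (const-PR 0) (app +-PR (var 2F ∷ var 1F ∷ []))
  (λ { (x ∷ []) → refl }) (λ { y (x ∷ []) → refl })

pred-PR : Prim 1 pred
pred-PR = recursive pred (const-PR 0) (var 0F) (λ { [] → refl }) (λ { y [] → refl })

∸-PR : Prim 2 _∸_
∸-PR = define _∸_ (app swapped (var 1F ∷ var 0F ∷ [])) (λ { (x ∷ y ∷ []) → refl })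
  where
  -- `recᶠ` recurses on its first argument, truncated subtraction on the subtrahend.
  swapped : Prim 2 (λ y x → x ∸ y)
  swapped = recursive (λ y x → x ∸ y) (var 0F) (app pred-PR (var 1F ∷ []))
    (λ { (x ∷ []) → refl }) (λ { y (x ∷ []) → sym (pred[m∸n]≡m∸[1+n] x y) })

ifz : ℕ → ℕ → ℕ → ℕ
ifz zero    x y = x
ifz (suc _) x y = y

ifz-PR : Prim 3 ifz
ifz-PR = recursive ifz (var 0F) (var 3F)
  (λ { (x ∷ y ∷ []) → refl }) (λ { c (x ∷ y ∷ []) → refl })

ifz-elim : ∀ (P : ℕ → Set) c {x y} → (c ≡ 0 → P x) → (c ≢ 0 → P y) → P (ifz c x y)
ifz-elim P zero    px py = px refl
ifz-elim P (suc c) px py = py λ ()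

ifz-≡0 : ∀ {c x y} → c ≡ 0 → ifz c x y ≡ x
ifz-≡0 refl = refl

ifz-≢0 : ∀ {c x y} → c ≢ 0 → ifz c x y ≡ y
ifz-≢0 {zero}  c≢0 = contradiction refl c≢0
ifz-≢0 {suc c} c≢0 = refl

-- The absolute difference, which turns a test for equality into a test for zero.
dist : ℕ → ℕ → ℕ
dist x y = (x ∸ y) + (y ∸ x)

dist-PR : Prim 2 dist
dist-PR = define dist
  (app +-PR (app ∸-PR (var 0F ∷ var 1F ∷ []) ∷ app ∸-PR (var 1F ∷ var 0F ∷ []) ∷ []))
  (λ { (x ∷ y ∷ []) → refl })

≡⇒dist≡0 : ∀ {x y} → x ≡ y → dist x y ≡ 0
≡⇒dist≡0 {x} refl rewrite n∸n≡0 x = refl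

dist≡0⇒≡ : ∀ x y → dist x y ≡ 0 → x ≡ y
dist≡0⇒≡ x y d≡0 = ≤-antisym
  (m∸n≡0⇒m≤n (m+n≡0⇒m≡0 (x ∸ y) d≡0)) (m∸n≡0⇒m≤n (m+n≡0⇒n≡0 (x ∸ y) d≡0))

-- Binary digits

parity : ℕ → ℕ
parity zero    = 0
parity (suc n) = 1 ∸ parity n

-- The floor of `n / 2`, which grows from `n` to `suc n` exactly when `n` is odd.
half : ℕ → ℕ
half zero    = 0
half (suc n) = half n + parity n

shift : ℕ → ℕ → ℕ
shift zero    n = n
shift (suc e) n = half (shift e n)

bit : ℕ → ℕ → ℕ
bit e n = parity (shift e n)

parity-PR : Prim 1 parity
parity-PR = recursive parity (const-PR 0) (app ∸-PR (const-PR 1 ∷ var 1F ∷ []))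
  (λ { [] → refl }) (λ { y [] → refl })

half-PR : Prim 1 half
half-PR = recursive half (const-PR 0)
  (app +-PR (var 1F ∷ app parity-PR (var 0F ∷ []) ∷ []))
  (λ { [] → refl }) (λ { y [] → refl })

shift-PR : Prim 2 shift
shift-PR = recursive shift (var 0F) (app half-PR (var 1F ∷ []))
  (λ { (x ∷ []) → refl }) (λ { y (x ∷ []) → refl })

bit-PR : Prim 2 bit
bit-PR = define bit (app parity-PR (app shift-PR (var 0F ∷ var 1F ∷ []) ∷ []))
  (λ { (x ∷ y ∷ []) → refl })

parity≤1 : ∀ n → parity n ≤ 1
parity≤1 zero    = z≤n
parity≤1 (suc n) = m∸n≤m 1 (parity n)

half+parity : ∀ n → n ≡ half n + half n + parity n
half+parity zero    = refl
half+parity (suc n) with parity n | parity≤1 n | half+parity n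
... | 0 | _ | eq rewrite +-identityʳ (half n) | +-identityʳ (half n + half n) =
  trans (cong suc eq) (+-comm 1 _)
... | 1 | _ | eq rewrite +-comm (half n) 1 =
  cong suc (trans eq (trans (+-comm _ 1)
    (trans (sym (+-suc (half n) (half n))) (sym (+-identityʳ _)))))
... | suc (suc _) | s≤s () | _

half-suc-suc : ∀ n → half (2 + n) ≡ suc (half n)
half-suc-suc n with parity n | parity≤1 n
... | 0 | _ rewrite +-identityʳ (half n) = +-comm (half n) 1
... | 1 | _ = trans (+-identityʳ _) (+-comm (half n) 1)
... | suc (suc _) | s≤s ()

parity-suc-suc : ∀ n → parity (2 + n) ≡ parity n
parity-suc-suc n with parity n | parity≤1 n
... | 0 | _ = refl
... | 1 | _ = refl
... | suc (suc _) | s≤s ()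

half-append : ∀ {d} → d ≤ 1 → ∀ n → half (d + (n + n)) ≡ n
half-append z≤n       zero = refl
half-append (s≤s z≤n) zero = refl
half-append {d} d≤1 (suc n)
  rewrite +-suc n n | +-suc d (suc (n + n)) | +-suc d (n + n) =
  trans (half-suc-suc (d + (n + n))) (cong suc (half-append d≤1 n))

parity-append : ∀ {d} → d ≤ 1 → ∀ n → parity (d + (n + n)) ≡ d
parity-append z≤n       zero = refl
parity-append (s≤s z≤n) zero = refl
parity-append {d} d≤1 (suc n)
  rewrite +-suc n n | +-suc d (suc (n + n)) | +-suc d (n + n) =
  trans (parity-suc-suc (d + (n + n))) (parity-append d≤1 n)

shift-half : ∀ e n → shift (suc e) n ≡ shift e (half n)
shift-half zero    n = refl
shift-half (suc e) n = cong half (shift-half e n)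

-- A zero shift by `e` means at most `e` binary digits. This later leaves only finitely many short
-- patterns.
shift≡0⇒<2^ : ∀ e n → shift e n ≡ 0 → n < 2 ^ e
shift≡0⇒<2^ zero    n refl = s≤s z≤n
shift≡0⇒<2^ (suc e) n eq   = begin-strict
  n                                ≡⟨ half+parity n ⟩
  half n + half n + parity n       <⟨ +-monoʳ-< (half n + half n) (s≤s (parity≤1 n)) ⟩
  half n + half n + 2              ≡⟨ +-assoc (half n) (half n) 2 ⟩
  half n + (half n + 2)            ≡⟨ cong (half n +_) (+-comm (half n) 2) ⟩
  half n + suc (suc (half n))      ≡⟨ +-suc (half n) (suc (half n)) ⟩
  suc (half n) + suc (half n)      ≤⟨ +-mono-≤ half< half< ⟩
  2 ^ e + 2 ^ e                    ≡⟨ cong (2 ^ e +_) (sym (+-identityʳ (2 ^ e))) ⟩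
  2 ^ suc e                        ∎
  where
  open ≤-Reasoning
  half< : half n < 2 ^ e
  half< = shift≡0⇒<2^ e (half n) (trans (sym (shift-half e n)) eq)

half≤ : ∀ n → half (suc n) ≤ n
half≤ zero    = z≤n
half≤ (suc n) rewrite half-suc-suc n = s≤s (≤-trans (half≤half-suc n) (half≤ n))
  where
  half≤half-suc : ∀ n → half n ≤ half (suc n)
  half≤half-suc n = m≤m+n (half n) (parity n)

-- Each halving lowers a positive number by at least one.
shift≤∸ : ∀ e n → shift e n ≤ n ∸ e
shift≤∸ zero    n = ≤-refl
shift≤∸ (suc e) n = subst (half (shift e n) ≤_) (pred[m∸n]≡m∸[1+n] n e)
  (≤-trans (half≤pred (shift e n)) (pred-mono-≤ (shift≤∸ e n)))
  where
  half≤pred : ∀ m → half m ≤ pred m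
  half≤pred zero    = z≤n
  half≤pred (suc m) = half≤ m

shift≢0⇒< : ∀ e n → shift e n ≢ 0 → e < n
shift≢0⇒< e n neq with e <? n
... | yes e<n = e<n
... | no  e≮n = contradiction
  (n≤0⇒n≡0 (subst (shift e n ≤_) (m≤n⇒m∸n≡0 (≮⇒≥ e≮n)) (shift≤∸ e n))) neq

-- The leading digit 1 of build p k marks the length of the pattern.
build : (ℕ → ℕ) → ℕ → ℕ
build p zero    = 1
build p (suc k) = p 0 + (build (p ∘ suc) k + build (p ∘ suc) k)

shift-build : ∀ e p k → (∀ e → p e ≤ 1) →
              shift (suc e) (build p (suc k)) ≡ shift e (build (p ∘ suc) k)
shift-build e p k p≤1 =
  trans (shift-half e (build p (suc k))) (cong (shift e) (half-append (p≤1 0) (build (p ∘ suc) k)))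

bit-build : ∀ p → (∀ e → p e ≤ 1) → ∀ {e k} → e < k → bit e (build p k) ≡ p e
bit-build p p≤1 {zero}  {suc k} _         = parity-append (p≤1 0) (build (p ∘ suc) k)
bit-build p p≤1 {suc e} {suc k} (s≤s e<k) =
  trans (cong parity (shift-build e p k p≤1)) (bit-build (p ∘ suc) (p≤1 ∘ suc) e<k)

-- The leading 1 of `build p k` is digit `k`, so every shift by more than `k` gives zero.
shift-build≢0 : ∀ p → (∀ e → p e ≤ 1) → ∀ e k → shift (suc e) (build p k) ≢ 0 → e < k
shift-build≢0 p p≤1 e       zero    neq with shift≢0⇒< (suc e) 1 neq
... | s≤s ()
shift-build≢0 p p≤1 zero    (suc k) neq = s≤s z≤n
shift-build≢0 p p≤1 (suc e) (suc k) neq =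
  s≤s (shift-build≢0 (p ∘ suc) (p≤1 ∘ suc) e k (neq ∘ trans (shift-build (suc e) p k p≤1)))

k<build : ∀ p k → k < build p k
k<build p zero    = s≤s z≤n
k<build p (suc k) = begin-strict
  suc k                                        ≤⟨ k<build (p ∘ suc) k ⟩
  build (p ∘ suc) k                            <⟨ m<m+n _ (m<n⇒0<n (k<build (p ∘ suc) k)) ⟩
  build (p ∘ suc) k + build (p ∘ suc) k        ≤⟨ m≤n+m _ (p 0) ⟩
  build p (suc k)                              ∎
  where open ≤-Reasoning

-- Pairing

-- The floor of the square root: it grows at `suc n` exactly when the next square is at most
-- `suc n`.
root : ℕ → ℕ
root zero    = 0
root (suc n) = root n + ifz (suc (root n) * suc (root n) ∸ suc n) 1 0

root-PR : Prim 1 root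
root-PR = recursive root (const-PR 0)
  (app +-PR (var 1F ∷
    app ifz-PR (app ∸-PR (app *-PR (r+1 ∷ r+1 ∷ []) ∷ app suc-PR (var 0F ∷ []) ∷ []) ∷
      const-PR 1 ∷ const-PR 0 ∷ []) ∷ []))
  (λ { [] → refl }) (λ { y [] → refl })
  where
  r+1 : PR {2} (λ xs → suc (lookup xs 1F))
  r+1 = app suc-PR (var 1F ∷ [])

root-spec : ∀ n → root n * root n ≤ n × n < suc (root n) * suc (root n)
root-spec zero    = z≤n , s≤s z≤n
root-spec (suc n) =
  ifz-elim (λ d → (root n + d) * (root n + d) ≤ suc n ×
                  suc n < suc (root n + d) * suc (root n + d))
    (suc (root n) * suc (root n) ∸ suc n) below above
  where
  r = root n
  below : suc r * suc r ∸ suc n ≡ 0 →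
          (r + 1) * (r + 1) ≤ suc n × suc n < suc (r + 1) * suc (r + 1)
  below eq rewrite +-comm r 1 =
    m∸n≡0⇒m≤n eq ,
    ≤-<-trans (proj₂ (root-spec n)) (*-mono-< (n<1+n (suc r)) (n<1+n (suc r)))
  above : suc r * suc r ∸ suc n ≢ 0 →
          (r + 0) * (r + 0) ≤ suc n × suc n < suc (r + 0) * suc (r + 0)
  above neq rewrite +-identityʳ r =
    m≤n⇒m≤1+n (proj₁ (root-spec n)) , ≰⇒> (λ le → neq (m≤n⇒m∸n≡0 le))

root-unique : ∀ {r n} → r * r ≤ n → n < suc r * suc r → root n ≡ r
root-unique {r} {n} lo hi =
  ≤-antisym (≮⇒≥ λ r<s → <-irrefl refl (<-≤-trans hi
              (≤-trans (*-mono-≤ r<s r<s) (proj₁ (root-spec n)))))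
            (≮⇒≥ λ s<r → <-irrefl refl (<-≤-trans (proj₂ (root-spec n))
              (≤-trans (*-mono-≤ s<r s<r) lo)))

opaque
  -- The value lies between the squares of `a + b` and `suc (a + b)`, so `root` recovers the sum and
  -- the remainder is `a`. Opaque, so that configurations stay nests of `pair` that `fst-pair` and
  -- `snd-pair` can rewrite.
  pair : ℕ → ℕ → ℕ
  pair a b = (a + b) * (a + b) + a

  fst : ℕ → ℕ
  fst n = n ∸ root n * root n

  snd : ℕ → ℕ
  snd n = root n ∸ fst n

  pair-PR : Prim 2 pair
  pair-PR = define pair
    (app +-PR (app *-PR (a+b ∷ a+b ∷ []) ∷ var 0F ∷ [])) (λ { (x ∷ y ∷ []) → refl })
    where
    a+b : PR {2} (λ xs → lookup xs 0F + lookup xs 1F)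
    a+b = app +-PR (var 0F ∷ var 1F ∷ [])

  fst-PR : Prim 1 fst
  fst-PR = define fst
    (app ∸-PR (var 0F ∷ app *-PR (r ∷ r ∷ []) ∷ [])) (λ { (x ∷ []) → refl })
    where
    r : PR {1} (λ xs → root (lookup xs 0F))
    r = app root-PR (var 0F ∷ [])

  snd-PR : Prim 1 snd
  snd-PR = define snd
    (app ∸-PR (app root-PR (var 0F ∷ []) ∷ app fst-PR (var 0F ∷ []) ∷ []))
    (λ { (x ∷ []) → refl })

  root-pair : ∀ a b → root (pair a b) ≡ a + b
  root-pair a b = root-unique (m≤m+n _ a) (begin-strict
    (a + b) * (a + b) + a                          ≤⟨ +-monoʳ-≤ _ (m≤m+n a b) ⟩
    (a + b) * (a + b) + (a + b)                    ≡⟨ +-comm _ (a + b) ⟩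
    (a + b) + (a + b) * (a + b)                    ≡⟨ sym (*-suc (a + b) (a + b)) ⟩
    (a + b) * suc (a + b)                          <⟨ *-monoˡ-< (suc (a + b)) (n<1+n (a + b)) ⟩
    suc (a + b) * suc (a + b)                      ∎)
    where open ≤-Reasoning

  fst-pair : ∀ a b → fst (pair a b) ≡ a
  fst-pair a b rewrite root-pair a b = m+n∸m≡n ((a + b) * (a + b)) a

  snd-pair : ∀ a b → snd (pair a b) ≡ b
  snd-pair a b rewrite fst-pair a b | root-pair a b = m+n∸m≡n a b

  pair-0-0 : pair 0 0 ≡ 0
  pair-0-0 = refl

  fst≤ : ∀ n → fst n ≤ n
  fst≤ n = m∸n≤m n (root n * root n)

  fst≤pair : ∀ a b → a ≤ pair a b
  fst≤pair a b = m≤n+m a _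

  pair-mono : ∀ {a a′ b b′} → a ≤ a′ → b ≤ b′ → pair a b ≤ pair a′ b′
  pair-mono a≤ b≤ = +-mono-≤ (*-mono-≤ (+-mono-≤ a≤ b≤) (+-mono-≤ a≤ b≤)) a≤

  -- Equality fails: pair is not surjective.
  ≤pair-fst-snd : ∀ n → n ≤ pair (fst n) (snd n)
  ≤pair-fst-snd n = begin
    n                              ≡⟨ sym (m+[n∸m]≡n (proj₁ (root-spec n))) ⟩
    root n * root n + fst n        ≤⟨ +-monoˡ-≤ (fst n) (*-mono-≤ root≤ root≤) ⟩
    pair (fst n) (snd n)           ∎
    where
    open ≤-Reasoning
    root≤ : root n ≤ fst n + snd n
    root≤ = m≤n+m∸n (root n) (fst n)

-- A stack machine for partial recursive functions

config : ℕ → ℕ → ℕ → ℕ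
config c k v = pair (pair c k) v

-- An instruction is a pair of a tag and a payload, a configuration is a pair
-- of a stack of instructions and a value.  The empty stack is 0, and 0 is
-- also an instruction with tag 0, on which the machine halts.  Instructions
-- 7, 8, 10 and 12 are the return frames of 6, 9 and 11.
execute : ℕ → ℕ → ℕ → ℕ → ℕ
execute 0  q k v = pair 0 v
execute 1  q k v = pair k 0
execute 2  q k v = pair k (suc (fst v))
execute 3  q k v = pair k (fst v)
execute 4  q k v = pair k (snd v)
execute 5  q k v = config (fst q) (pair (snd q) k) v
execute 6  q k v = config (fst q) (pair (pair 7 (pair (snd q) v)) k) v
execute 7  q k v = config (fst q) (pair (pair 8 v) k) (snd q)
execute 8  q k v = pair k (pair q v)
execute 9  q k v = ifz (fst v)
  (config (fst q) k (snd v))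
  (config (pair 9 q) (pair (pair 10 (pair (snd q) (pair (pred (fst v)) (snd v)))) k)
    (pair (pred (fst v)) (snd v)))
execute 10 q k v = config (fst q) k (pair (fst (snd q)) (pair v (snd (snd q))))
execute 11 q k v = config q (pair (pair 12 (pair q v)) k) v
execute 12 q k v = ifz v
  (pair k (fst (snd q)))
  (config (pair 11 (fst q)) k (pair (suc (fst (snd q))) (snd (snd q))))
execute 13 q k v = config (pair 11 q) k (pair 0 v)
execute _  q k v = pair 0 v

execute-PR : Prim 4 execute
execute-PR = define execute
  (case 0 (pairᵖ (const-PR 0) v) (case 1 (pairᵖ k (const-PR 0))
  (case 2 (pairᵖ k (sucᵖ (fstᵖ v))) (case 3 (pairᵖ k (fstᵖ v)) (case 4 (pairᵖ k (sndᵖ v))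
  (case 5 (configᵖ (fstᵖ q) (pairᵖ (sndᵖ q) k) v)
  (case 6 (configᵖ (fstᵖ q) (pairᵖ (pairᵖ (const-PR 7) (pairᵖ (sndᵖ q) v)) k) v)
  (case 7 (configᵖ (fstᵖ q) (pairᵖ (pairᵖ (const-PR 8) v) k) (sndᵖ q))
  (case 8 (pairᵖ k (pairᵖ q v))
  (case 9 (app ifz-PR (fstᵖ v ∷ configᵖ (fstᵖ q) k (sndᵖ v) ∷
    configᵖ (pairᵖ (const-PR 9) q) (pairᵖ (pairᵖ (const-PR 10) (pairᵖ (sndᵖ q) pred-v)) k)
      pred-v ∷ []))
  (case 10 (configᵖ (fstᵖ q) k (pairᵖ (fstᵖ (sndᵖ q)) (pairᵖ v (sndᵖ (sndᵖ q)))))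
  (case 11 (configᵖ q (pairᵖ (pairᵖ (const-PR 12) (pairᵖ q v)) k) v)
  (case 12 (app ifz-PR (v ∷ pairᵖ k (fstᵖ (sndᵖ q)) ∷
    configᵖ (pairᵖ (const-PR 11) (fstᵖ q)) k
      (pairᵖ (sucᵖ (fstᵖ (sndᵖ q))) (sndᵖ (sndᵖ q))) ∷ []))
  (case 13 (configᵖ (pairᵖ (const-PR 11) q) k (pairᵖ (const-PR 0) v))
  (pairᵖ (const-PR 0) v)))))))))))))))
  λ { (0  ∷ q ∷ k ∷ v ∷ []) → refl
    ; (1  ∷ q ∷ k ∷ v ∷ []) → refl
    ; (2  ∷ q ∷ k ∷ v ∷ []) → refl
    ; (3  ∷ q ∷ k ∷ v ∷ []) → refl
    ; (4  ∷ q ∷ k ∷ v ∷ []) → refl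
    ; (5  ∷ q ∷ k ∷ v ∷ []) → refl
    ; (6  ∷ q ∷ k ∷ v ∷ []) → refl
    ; (7  ∷ q ∷ k ∷ v ∷ []) → refl
    ; (8  ∷ q ∷ k ∷ v ∷ []) → refl
    ; (9  ∷ q ∷ k ∷ v ∷ []) → refl
    ; (10 ∷ q ∷ k ∷ v ∷ []) → refl
    ; (11 ∷ q ∷ k ∷ v ∷ []) → refl
    ; (12 ∷ q ∷ k ∷ v ∷ []) → refl
    ; (13 ∷ q ∷ k ∷ v ∷ []) → refl
    ; (suc (suc (suc (suc (suc (suc (suc (suc (suc (suc (suc (suc (suc (suc t)))))))))))))
         ∷ q ∷ k ∷ v ∷ []) → refl }
  where
  q = var {4} 1F
  k = var {4} 2F
  v = var {4} 3F

  sucᵖ : {F : Vec ℕ 4 → ℕ} → PR F → PR (λ xs → suc (F xs))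
  sucᵖ p = app suc-PR (p ∷ [])

  fstᵖ : {F : Vec ℕ 4 → ℕ} → PR F → PR (λ xs → fst (F xs))
  fstᵖ p = app fst-PR (p ∷ [])

  sndᵖ : {F : Vec ℕ 4 → ℕ} → PR F → PR (λ xs → snd (F xs))
  sndᵖ p = app snd-PR (p ∷ [])

  pairᵖ : {F G : Vec ℕ 4 → ℕ} → PR F → PR G → PR (λ xs → pair (F xs) (G xs))
  pairᵖ p q = app pair-PR (p ∷ q ∷ [])

  configᵖ : {F G H : Vec ℕ 4 → ℕ} → PR F → PR G → PR H →
            PR (λ xs → config (F xs) (G xs) (H xs))
  configᵖ p q r = pairᵖ (pairᵖ p q) r

  pred-v : PR {4} (λ xs → pair (pred (fst (lookup xs 3F))) (snd (lookup xs 3F)))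
  pred-v = pairᵖ (app pred-PR (fstᵖ v ∷ [])) (sndᵖ v)

  -- The test is whether the tag is at most `t`; nested with `t` increasing, it singles out the tag
  -- `t`.
  case : {F G : Vec ℕ 4 → ℕ} (t : ℕ) → PR F → PR G →
         PR (λ xs → ifz (lookup xs 0F ∸ t) (F xs) (G xs))
  case t p q = app ifz-PR (app ∸-PR (var 0F ∷ const-PR t ∷ []) ∷ p ∷ q ∷ [])

step : ℕ → ℕ
step s = execute (fst (fst (fst s))) (snd (fst (fst s))) (snd (fst s)) (snd s)

run : ℕ → ℕ → ℕ
run zero    s = s
run (suc n) s = step (run n s)

step-PR : Prim 1 step
step-PR = define step
  (app execute-PR (app fst-PR (instr ∷ []) ∷ app snd-PR (instr ∷ []) ∷
    app snd-PR (stack ∷ []) ∷ app snd-PR (var 0F ∷ []) ∷ []))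
  (λ { (s ∷ []) → refl })
  where
  stack : PR {1} (λ xs → fst (lookup xs 0F))
  stack = app fst-PR (var 0F ∷ [])
  instr : PR {1} (λ xs → fst (fst (lookup xs 0F)))
  instr = app fst-PR (stack ∷ [])

run-PR : Prim 2 run
run-PR = recursive run (var 0F) (app step-PR (var 1F ∷ []))
  (λ { (s ∷ []) → refl }) (λ { n (s ∷ []) → refl })

step-config : ∀ t q k v → step (config (pair t q) k v) ≡ execute t q k v
step-config t q k v
  rewrite fst-pair (pair (pair t q) k) v | snd-pair (pair (pair t q) k) v
        | fst-pair (pair t q) k | snd-pair (pair t q) k
        | fst-pair t q | snd-pair t q = refl

fst-0 : fst 0 ≡ 0
fst-0 = subst (λ n → fst n ≡ 0) pair-0-0 (fst-pair 0 0)

step-halted : ∀ v → step (pair 0 v) ≡ pair 0 v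
step-halted v rewrite fst-pair 0 v | snd-pair 0 v | fst-0 | fst-0 = refl

run-+ : ∀ m n s → run (m + n) s ≡ run m (run n s)
run-+ zero    n s = refl
run-+ (suc m) n s = cong step (run-+ m n s)

run-halted : ∀ n v → run n (pair 0 v) ≡ pair 0 v
run-halted zero    v = refl
run-halted (suc n) v = trans (cong step (run-halted n v)) (step-halted v)

infix 4 _⟶*_
_⟶*_ : ℕ → ℕ → Set
s ⟶* s′ = ∃[ n ] run n s ≡ s′

-- A halted configuration no longer changes, so both runs, prolonged to `m + n` steps, end in the
-- same one.
halt-unique : ∀ {s v w} → s ⟶* pair 0 v → s ⟶* pair 0 w → v ≡ w
halt-unique {s} {v} {w} (m , p) (n , q) = begin
  v                      ≡⟨ sym (snd-pair 0 v) ⟩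
  snd (pair 0 v)         ≡⟨ cong snd (sym (run-halted n v)) ⟩
  snd (run n (pair 0 v)) ≡⟨ cong (snd ∘ run n) (sym p) ⟩
  snd (run n (run m s))  ≡⟨ cong snd (sym (run-+ n m s)) ⟩
  snd (run (n + m) s)    ≡⟨ cong (λ l → snd (run l s)) (+-comm n m) ⟩
  snd (run (m + n) s)    ≡⟨ cong snd (run-+ m n s) ⟩
  snd (run m (run n s))  ≡⟨ cong (snd ∘ run m) q ⟩
  snd (run m (pair 0 w)) ≡⟨ cong snd (run-halted m w) ⟩
  snd (pair 0 w)         ≡⟨ snd-pair 0 w ⟩
  w                      ∎
  where open ≡-Reasoning

⟶*-trans : ∀ {s t u} → s ⟶* t → t ⟶* u → s ⟶* u
⟶*-trans {s} (m , p) (n , q) = n + m , trans (run-+ n m s) (trans (cong (run n) p) q)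

-- c takes v to w in every continuation k.
Runs : ℕ → ℕ → ℕ → Set
Runs c v w = ∀ k → config c k v ⟶* pair k w

-- Compilation of partial recursive functions

proj-code : ∀ {n} → Fin n → ℕ
proj-code zero    = pair 3 0
proj-code (suc i) = pair 5 (pair (pair 4 0) (proj-code i))

mutual
  -- Tag 5 composes, 6 pairs two results, 9 recurses on the first component of the value, and 13
  -- starts the search 11 at 0.
  compile : ∀ {n} → PartRec n → ℕ
  compile zeroᶠ        = pair 1 0
  compile sucᶠ         = pair 2 0
  compile (projᶠ i)    = proj-code i
  compile (compᶠ f gs) = pair 5 (pair (compile* gs) (compile f))
  compile (recᶠ f g)   = pair 9 (pair (compile f) (compile g))
  compile (μᶠ f)       = pair 13 (compile f)

  compile* : ∀ {m n} → Vec (PartRec n) m → ℕ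
  compile* []       = pair 1 0
  compile* (g ∷ gs) = pair 6 (pair (compile g) (compile* gs))

encode : ∀ {n} → Vec ℕ n → ℕ
encode []       = 0
encode (x ∷ xs) = pair x (encode xs)

step⟶* : ∀ t q k v {s} → execute t q k v ≡ s → config (pair t q) k v ⟶* s
step⟶* t q k v eq = 1 , trans (step-config t q k v) eq

zero-runs : ∀ v → Runs (pair 1 0) v 0
zero-runs v k = step⟶* 1 0 k v refl

seq-runs : ∀ {f g u v w} → Runs f u v → Runs g v w → Runs (pair 5 (pair f g)) u w
seq-runs {f} {g} {u} p q k = ⟶*-trans
  (step⟶* 5 (pair f g) k u
    (cong₂ (λ f g → config f (pair g k) u) (fst-pair f g) (snd-pair f g)))
  (⟶*-trans (p (pair g k)) (q k))

pair-runs : ∀ {f g u v w} → Runs f u v → Runs g u w → Runs (pair 6 (pair f g)) u (pair v w)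
pair-runs {f} {g} {u} {v} {w} p q k = ⟶*-trans
  (step⟶* 6 (pair f g) k u
    (cong₂ (λ f g → config f (pair (pair 7 (pair g u)) k) u) (fst-pair f g) (snd-pair f g)))
  (⟶*-trans (p (pair (pair 7 (pair g u)) k))
  (⟶*-trans (step⟶* 7 (pair g u) k v
    (cong₂ (λ g u → config g (pair (pair 8 v) k) u) (fst-pair g u) (snd-pair g u)))
  (⟶*-trans (q (pair (pair 8 v) k)) (step⟶* 8 v k w refl))))

proj-runs : ∀ {n} (i : Fin n) xs → Runs (proj-code i) (encode xs) (lookup xs i)
proj-runs zero    (x ∷ xs) k =
  step⟶* 3 0 k _ (cong (pair k) (fst-pair x (encode xs)))
proj-runs (suc i) (x ∷ xs) = seq-runs
  (λ k → step⟶* 4 0 k _ (cong (pair k) (snd-pair x (encode xs))))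
  (proj-runs i xs)

rec-zero-runs : ∀ {f g v w} → Runs f v w → Runs (pair 9 (pair f g)) (pair 0 v) w
rec-zero-runs {f} {g} {v} p k = ⟶*-trans
  (step⟶* 9 (pair f g) k (pair 0 v) eq) (p k)
  where
  eq : execute 9 (pair f g) k (pair 0 v) ≡ config f k v
  eq rewrite fst-pair 0 v | snd-pair 0 v | fst-pair f g = refl

rec-suc-runs : ∀ {f g y v z w} → Runs (pair 9 (pair f g)) (pair y v) z →
               Runs g (pair y (pair z v)) w → Runs (pair 9 (pair f g)) (pair (suc y) v) w
rec-suc-runs {f} {g} {y} {v} {z} p q k = ⟶*-trans
  (step⟶* 9 (pair f g) k (pair (suc y) v) eq)
  (⟶*-trans (p (pair frame k))
  (⟶*-trans (step⟶* 10 (pair g (pair y v)) k z eq′) (q k)))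
  where
  frame : ℕ
  frame = pair 10 (pair g (pair y v))
  eq : execute 9 (pair f g) k (pair (suc y) v) ≡
       config (pair 9 (pair f g)) (pair frame k) (pair y v)
  eq rewrite fst-pair (suc y) v | snd-pair (suc y) v | snd-pair f g = refl
  eq′ : execute 10 (pair g (pair y v)) k z ≡ config g k (pair y (pair z v))
  eq′ rewrite fst-pair g (pair y v) | snd-pair g (pair y v)
            | fst-pair y v | snd-pair y v = refl

search-hit-runs : ∀ {f i v} → Runs f (pair i v) 0 → Runs (pair 11 f) (pair i v) i
search-hit-runs {f} {i} {v} p k = ⟶*-trans
  (step⟶* 11 f k (pair i v) refl)
  (⟶*-trans (p (pair (pair 12 (pair f (pair i v))) k))
    (step⟶* 12 (pair f (pair i v)) k 0 eq))
  where
  eq : execute 12 (pair f (pair i v)) k 0 ≡ pair k i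
  eq rewrite snd-pair f (pair i v) | fst-pair i v = refl

search-miss-runs : ∀ {f i v r w} → Runs f (pair i v) (suc r) →
                   Runs (pair 11 f) (pair (suc i) v) w → Runs (pair 11 f) (pair i v) w
search-miss-runs {f} {i} {v} {r} p q k = ⟶*-trans
  (step⟶* 11 f k (pair i v) refl)
  (⟶*-trans (p (pair (pair 12 (pair f (pair i v))) k))
  (⟶*-trans (step⟶* 12 (pair f (pair i v)) k (suc r) eq) (q k)))
  where
  eq : execute 12 (pair f (pair i v)) k (suc r) ≡ config (pair 11 f) k (pair (suc i) v)
  eq rewrite fst-pair f (pair i v) | snd-pair f (pair i v)
           | fst-pair i v | snd-pair i v = refl

-- Induction on the number `d` of misses left before the zero at `y`.
search-runs : ∀ {f v y} → Runs f (pair y v) 0 →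
              (∀ i → i < y → ∃[ r ] Runs f (pair i v) (suc r)) →
              ∀ d i → d + i ≡ y → Runs (pair 11 f) (pair i v) y
search-runs p q zero    i refl = search-hit-runs p
search-runs p q (suc d) i refl =
  search-miss-runs (proj₂ (q i (s≤s (m≤n+m i d)))) (search-runs p q d (suc i) (+-suc d i))

compile*-runs : ∀ {m n v} (gs : Vec (PartRec n) m) (ys : Vec ℕ m) →
                (∀ i → Runs (compile (lookup gs i)) v (lookup ys i)) →
                Runs (compile* gs) v (encode ys)
compile*-runs []       []       rs = zero-runs _
compile*-runs (g ∷ gs) (y ∷ ys) rs =
  pair-runs (rs zero) (compile*-runs gs ys (λ i → rs (suc i)))

compile-runs : ∀ {n} {f : PartRec n} {xs y} → f [ xs ]⇓ y →
               Runs (compile f) (encode xs) y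
compile-runs ⇓zero = zero-runs _
compile-runs (⇓suc {x}) k =
  step⟶* 2 0 k _ (cong (λ x → pair k (suc x)) (fst-pair x 0))
compile-runs (⇓proj {xs = xs} i) = proj-runs i xs
compile-runs (⇓comp {gs = gs} ys ds d) =
  seq-runs (compile*-runs gs ys (λ i → compile-runs (ds i))) (compile-runs d)
compile-runs (⇓rec₀ d)   = rec-zero-runs (compile-runs d)
compile-runs (⇓rec₁ d e) = rec-suc-runs (compile-runs d) (compile-runs e)
compile-runs {f = μᶠ f} {xs} {y} (⇓μ d ds) k = ⟶*-trans
  (step⟶* 13 (compile f) k (encode xs) refl)
  (search-runs (compile-runs d)
    (λ i i<y → proj₁ (ds i i<y) , compile-runs (proj₂ (ds i i<y))) y 0 (+-identityʳ y) k)

-- Primitive recursive functions as partial recursive ones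

mutual
  embed : ∀ {n} → PrimRec n → PartRec n
  embed zeroᶠ        = zeroᶠ
  embed sucᶠ         = sucᶠ
  embed (projᶠ i)    = projᶠ i
  embed (compᶠ f gs) = compᶠ (embed f) (embed* gs)
  embed (recᶠ f g)   = recᶠ (embed f) (embed g)

  embed* : ∀ {m n} → Vec (PrimRec n) m → Vec (PartRec n) m
  embed* []       = []
  embed* (g ∷ gs) = embed g ∷ embed* gs

mutual
  embed-⇓ : ∀ {n} (f : PrimRec n) xs → embed f [ xs ]⇓ ⟦ f ⟧ xs
  embed-⇓ zeroᶠ        xs       = ⇓zero
  embed-⇓ sucᶠ         (x ∷ []) = ⇓suc
  embed-⇓ (projᶠ i)    xs       = ⇓proj i
  embed-⇓ (compᶠ f gs) xs       =
    ⇓comp (⟦ gs ⟧* xs) (embed*-⇓ gs xs) (embed-⇓ f (⟦ gs ⟧* xs))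
  embed-⇓ (recᶠ f g)   (y ∷ xs) = go y
    where
    go : ∀ y → recᶠ (embed f) (embed g) [ y ∷ xs ]⇓ natRec ⟦ f ⟧ ⟦ g ⟧ y xs
    go zero    = ⇓rec₀ (embed-⇓ f xs)
    go (suc y) = ⇓rec₁ (go y) (embed-⇓ g _)

  embed*-⇓ : ∀ {m n} (gs : Vec (PrimRec n) m) xs i →
             lookup (embed* gs) i [ xs ]⇓ lookup (⟦ gs ⟧* xs) i
  embed*-⇓ (g ∷ gs) xs zero    = embed-⇓ g xs
  embed*-⇓ (g ∷ gs) xs (suc i) = embed*-⇓ gs xs i

-- The Π₁ set

-- A run of `snd t` steps from the empty stack. Halting with output 0 is the configuration
-- `pair 0 0`, which is the number 0, so a product over `t` can record whether there was a hit.
member-run : ℕ → ℕ → ℕ → ℕ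
member-run e p t = run (snd t) (config e 0 (pair (fst t) (pair (snd p) (pair (fst p) 0))))

-- p = pair x y is enumerated by e if the program e outputs 0 on (z, y, x) for
-- some z; t = pair z n also bounds the number of steps.
Enumerated : ℕ → ℕ → Set
Enumerated e p = ∃[ t ] member-run e p t ≡ 0

unseen : ℕ → ℕ → ℕ → ℕ
unseen zero    e p = 1
unseen (suc s) e p = unseen s e p * member-run e p s

digit : ℕ → ℕ → ℕ
digit e x = bit e (fst x)

-- In `count`, the counter is itself the point `m` under inspection. It moves past `m` if `m` is
-- exempt, by a smaller first component or an equal digit, or has been seen; it stops for good once
-- `p` is seen.
advance : ℕ → ℕ → ℕ → ℕ → ℕ
advance s e p m =
  ifz (unseen s e p) 0
  (ifz (fst p ∸ fst m)
    (ifz (dist (digit e (fst m)) (digit e (fst p))) 1 (ifz (unseen s e m) 1 0))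
    1)

-- count s e p is unbounded in s exactly if p is not enumerated by e, but all
-- m are for which fst p ≤ fst m and fst m differs from fst p in digit e.
count : ℕ → ℕ → ℕ → ℕ
count zero    e p = 0
count (suc s) e p = count s e p + advance s e p (count s e p)

-- The first test asks whether `i` is below the length of `τ`, not counting the leading 1; the
-- second, whether `τ` agrees with the digit of requirement `i`, read as the pair (`fst i`,
-- `snd i`).
weight : ℕ → ℕ → ℕ → ℕ
weight τ s i =
  ifz (shift (suc i) τ) 0
  (ifz (dist (bit (fst i) τ) (digit (fst i) (fst (snd i)))) (count s (fst i) (snd i)) 0)

weights : ℕ → ℕ → ℕ → ℕ
weights zero    τ s = 0
weights (suc n) τ s = weights n τ s + weight τ s n

-- Summing over `i < τ` reaches all of the pattern, since `shift (suc i) τ` vanishes for `i ≥ τ`.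
total : ℕ → ℕ → ℕ
total τ s = weights τ τ s

-- check s x ≡ 0 iff (total (fst x) s ≡ total (fst x) (snd x) iff snd x ≤ s).
check : ℕ → ℕ → ℕ
check s x =
  ifz (suc s ∸ snd x)
    (ifz (dist (total (fst x) s) (total (fst x) (snd x))) 1 0)
    (dist (total (fst x) s) (total (fst x) (snd x)))

Settled : Subset
Settled x = ∀ s → check s x ≡ 0

-- Primitive recursiveness of `check` and of the digits

member-run-PR : Prim 3 member-run
member-run-PR = define member-run
  (app run-PR (app snd-PR (t ∷ []) ∷
    app pair-PR (app pair-PR (var 0F ∷ const-PR 0 ∷ []) ∷
      app pair-PR (app fst-PR (t ∷ []) ∷
        app pair-PR (app snd-PR (p ∷ []) ∷
          app pair-PR (app fst-PR (p ∷ []) ∷ const-PR 0 ∷ []) ∷ []) ∷ []) ∷ []) ∷ []))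
  (λ { (e ∷ p ∷ t ∷ []) → refl })
  where
  p = var {3} 1F
  t = var {3} 2F

unseen-PR : Prim 3 unseen
unseen-PR = recursive unseen (const-PR 1)
  (app *-PR (var 1F ∷ app member-run-PR (var 2F ∷ var 3F ∷ var 0F ∷ []) ∷ []))
  (λ { (e ∷ p ∷ []) → refl }) (λ { s (e ∷ p ∷ []) → refl })

digit-PR : Prim 2 digit
digit-PR = define digit (app bit-PR (var 0F ∷ app fst-PR (var 1F ∷ []) ∷ []))
  (λ { (e ∷ x ∷ []) → refl })

advance-PR : Prim 4 advance
advance-PR = define advance
  (app ifz-PR (app unseen-PR (s ∷ e ∷ p ∷ []) ∷ const-PR 0 ∷
    app ifz-PR (app ∸-PR (fst-p ∷ fst-m ∷ []) ∷
      app ifz-PR (app dist-PR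
          (app digit-PR (e ∷ fst-m ∷ []) ∷ app digit-PR (e ∷ fst-p ∷ []) ∷ []) ∷
        const-PR 1 ∷
        app ifz-PR (app unseen-PR (s ∷ e ∷ m ∷ []) ∷ const-PR 1 ∷ const-PR 0 ∷ []) ∷ []) ∷
      const-PR 1 ∷ []) ∷ []))
  (λ { (s ∷ e ∷ p ∷ m ∷ []) → refl })
  where
  s = var {4} 0F
  e = var {4} 1F
  p = var {4} 2F
  m = var {4} 3F
  fst-p : PR {4} (λ xs → fst (lookup xs 2F))
  fst-p = app fst-PR (p ∷ [])
  fst-m : PR {4} (λ xs → fst (lookup xs 3F))
  fst-m = app fst-PR (m ∷ [])

count-PR : Prim 3 count
count-PR = recursive count (const-PR 0)
  (app +-PR (var 1F ∷ app advance-PR (var 0F ∷ var 2F ∷ var 3F ∷ var 1F ∷ []) ∷ []))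
  (λ { (e ∷ p ∷ []) → refl }) (λ { s (e ∷ p ∷ []) → refl })

weight-PR : Prim 3 weight
weight-PR = define weight
  (app ifz-PR (app shift-PR (app suc-PR (i ∷ []) ∷ τ ∷ []) ∷ const-PR 0 ∷
    app ifz-PR (app dist-PR (app bit-PR (e ∷ τ ∷ []) ∷
        app digit-PR (e ∷ app fst-PR (p ∷ []) ∷ []) ∷ []) ∷
      app count-PR (var 1F ∷ e ∷ p ∷ []) ∷ const-PR 0 ∷ []) ∷ []))
  (λ { (τ ∷ s ∷ i ∷ []) → refl })
  where
  τ = var {3} 0F
  i = var {3} 2F
  e : PR {3} (λ xs → fst (lookup xs 2F))
  e = app fst-PR (i ∷ [])
  p : PR {3} (λ xs → snd (lookup xs 2F))
  p = app snd-PR (i ∷ [])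

weights-PR : Prim 3 weights
weights-PR = recursive weights (const-PR 0)
  (app +-PR (var 1F ∷ app weight-PR (var 2F ∷ var 3F ∷ var 0F ∷ []) ∷ []))
  (λ { (τ ∷ s ∷ []) → refl }) (λ { n (τ ∷ s ∷ []) → refl })

check-PR : Prim 2 check
check-PR = define check
  (app ifz-PR (app ∸-PR (app suc-PR (var 0F ∷ []) ∷ h ∷ []) ∷
    app ifz-PR (change ∷ const-PR 1 ∷ const-PR 0 ∷ []) ∷ change ∷ []))
  (λ { (s ∷ x ∷ []) → refl })
  where
  τ : PR {2} (λ xs → fst (lookup xs 1F))
  τ = app fst-PR (var 1F ∷ [])
  h : PR {2} (λ xs → snd (lookup xs 1F))
  h = app snd-PR (var 1F ∷ [])
  change : PR {2} (λ xs → dist (total (fst (lookup xs 1F)) (lookup xs 0F))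
                               (total (fst (lookup xs 1F)) (snd (lookup xs 1F))))
  change = app dist-PR
    (app weights-PR (τ ∷ τ ∷ var 0F ∷ []) ∷ app weights-PR (τ ∷ τ ∷ h ∷ []) ∷ [])

zero-set-computable : ∀ {n f} → Prim n f → Computable (λ xs → apply f xs ≡ 0)
zero-set-computable {n} {f} p = embed (code q) , λ xs → decide xs (apply f xs) refl
  where
  q : PR {n} (λ xs → ifz (apply f xs) 1 0)
  q = app ifz-PR (p ∷ const-PR 1 ∷ const-PR 0 ∷ [])
  value : ∀ {xs y} → ifz (apply f xs) 1 0 ≡ y → embed (code q) [ xs ]⇓ y
  value {xs} eq = subst (embed (code q) [ xs ]⇓_) (trans (correct q xs) eq) (embed-⇓ (code q) xs)
  decide : ∀ xs y → apply f xs ≡ y →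
           (apply f xs ≡ 0 × embed (code q) [ xs ]⇓ 1) ⊎
           (¬ apply f xs ≡ 0 × embed (code q) [ xs ]⇓ 0)
  decide xs zero    eq = inj₁ (eq , value (cong (λ y → ifz y 1 0) eq))
  decide xs (suc y) eq =
    inj₂ ((λ ≡0 → 1+n≢0 (trans (sym eq) ≡0)) , value (cong (λ y → ifz y 1 0) eq))

Settled-Π₁ : Π-set 1 Settled
Settled-Π₁ = forAll (λ xs → apply check xs ≡ 0) (computable (zero-set-computable check-PR))
  λ { (x ∷ []) → mk⇔ id id }

digit-primitiveRecursive : ∀ e → PrimitiveRecursive (λ x → digit e x ≡ 1)
digit-primitiveRecursive e = code p , λ { (x ∷ []) → decide x (digit e x) refl }
  where
  p : Prim 1 (digit e)
  p = define (digit e) (app digit-PR (const-PR e ∷ var 0F ∷ [])) λ { (x ∷ []) → refl }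
  decide : ∀ x d → digit e x ≡ d →
           (digit e x ≡ 1 × ⟦ code p ⟧ (x ∷ []) ≡ 1) ⊎
           (¬ digit e x ≡ 1 × ⟦ code p ⟧ (x ∷ []) ≡ 0)
  decide x 0 eq = inj₂ ((λ ≡1 → 0≢1+n (trans (sym eq) ≡1)) , trans (correct p (x ∷ [])) eq)
  decide x 1 eq = inj₁ (eq , trans (correct p (x ∷ [])) eq)
  decide x (suc (suc d)) eq =
    contradiction (subst (_≤ 1) eq (parity≤1 (shift e (fst x)))) λ { (s≤s ()) }

-- Monotone sequences

Bounded : (ℕ → ℕ) → Set
Bounded f = ∃[ b ] (∀ s → f s ≤ b)

Increasing : (ℕ → ℕ) → Set
Increasing f = ∀ s → f s ≤ f (suc s)

increasing-mono : ∀ {f} → Increasing f → ∀ {s t} → s ≤ t → f s ≤ f t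
increasing-mono {f} inc {s} s≤t = go (≤⇒≤′ s≤t)
  where
  go : ∀ {t} → s ≤′ t → f s ≤ f t
  go ≤′-refl       = ≤-refl
  go (≤′-step s≤t) = ≤-trans (go s≤t) (inc _)

-- Excluded middle decides whether the present value is ever exceeded; each excess uses up one of
-- the `d` units left below the bound.
bounded-stabilises : ∀ {f} → Increasing f → Bounded f →
                     ¬ ¬ (∃[ h ] (∀ s → h ≤ s → f s ≡ f h))
bounded-stabilises {f} inc (b , f≤b) = go b 0 λ s → ≤-trans (f≤b s) (m≤m+n b (f 0))
  where
  go : ∀ d h → (∀ s → f s ≤ d + f h) → ¬ ¬ (∃[ h ] (∀ s → h ≤ s → f s ≡ f h))
  go zero    h f≤ ¬lim = ¬lim (h , λ s h≤s → ≤-antisym (f≤ s) (increasing-mono inc h≤s))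
  go (suc d) h f≤ ¬lim = ¬¬-excluded-middle {A = ∃[ s ] f h < f s} λ
    { (yes (s , fh<fs)) →
        go d s (λ u → ≤-trans (f≤ u)
          (≤-trans (≤-reflexive (sym (+-suc d (f h)))) (+-monoʳ-≤ d fh<fs))) ¬lim
    ; (no ¬above) →
        ¬lim (h , λ s h≤s → ≤-antisym (≮⇒≥ (λ lt → ¬above (s , lt))) (increasing-mono inc h≤s)) }

-- Walk down from a stage past the limit until the value changes; by monotonicity, no earlier stage
-- has the final value.
modulus : ∀ {f} → Increasing f → ∀ h → (∀ s → h ≤ s → f s ≡ f h) →
          ∃[ h ] (∀ s → h ≤ s → f s ≡ f h) × (∀ s → s < h → f s ≢ f h)
modulus inc zero lim = 0 , lim , λ s ()
modulus {f} inc (suc h) lim with f h ≟ f (suc h)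
... | no  neq = suc h , lim , λ { s (s≤s s≤h) eq → neq
  (≤-antisym (inc h) (subst (_≤ f h) eq (increasing-mono inc s≤h))) }
... | yes eq  = modulus inc h earlier
  where
  earlier : ∀ s → h ≤ s → f s ≡ f h
  earlier s h≤s with m≤n⇒m<n∨m≡n h≤s
  ... | inj₁ h<s  = trans (lim s h<s) (sym eq)
  ... | inj₂ refl = refl

-- Active requirements

Active : ℕ → ℕ → Set
Active e p = ¬ Bounded (λ s → count s e p)

advance≤1 : ∀ s e p m → advance s e p m ≤ 1
advance≤1 s e p m =
  ifz-elim (_≤ 1) (unseen s e p) (λ _ → z≤n) λ _ →
  ifz-elim (_≤ 1) (fst p ∸ fst m)
    (λ _ → ifz-elim (_≤ 1) (dist (digit e (fst m)) (digit e (fst p))) (λ _ → ≤-refl) λ _ →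
      ifz-elim (_≤ 1) (unseen s e m) (λ _ → ≤-refl) (λ _ → z≤n))
    (λ _ → ≤-refl)

count-increasing : ∀ e p → Increasing (λ s → count s e p)
count-increasing e p s = m≤m+n (count s e p) _

seen : ∀ {e p t s} → member-run e p t ≡ 0 → t < s → unseen s e p ≡ 0
seen {e} {p} {t} hit t<s = go (≤⇒≤′ t<s)
  where
  go : ∀ {s} → suc t ≤′ s → unseen s e p ≡ 0
  go ≤′-refl         = trans (cong (unseen t e p *_) hit) (*-zeroʳ (unseen t e p))
  go (≤′-step t<s)   = cong (_* member-run e p _) (go t<s)

seen⇒enumerated : ∀ s {e p} → unseen s e p ≡ 0 → Enumerated e p
seen⇒enumerated (suc s) {e} {p} eq with m*n≡0⇒m≡0∨n≡0 (unseen s e p) eq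
... | inj₁ ≡0 = seen⇒enumerated s ≡0
... | inj₂ ≡0 = s , ≡0

-- Once `p` is seen, its counter is frozen.
active⇒¬enumerated : ∀ {e p} → Active e p → ¬ Enumerated e p
active⇒¬enumerated {e} {p} active (t , hit) = active (count (suc t) e p , bound)
  where
  constant : ∀ {s} → suc t ≤′ s → count s e p ≤ count (suc t) e p
  constant ≤′-refl = ≤-refl
  constant (≤′-step {s} t<s) = begin
    count s e p + advance s e p (count s e p)
      ≡⟨ cong (count s e p +_) (ifz-≡0 (seen hit (≤′⇒≤ t<s))) ⟩
    count s e p + 0    ≡⟨ +-identityʳ _ ⟩
    count s e p        ≤⟨ constant t<s ⟩
    count (suc t) e p  ∎
    where open ≤-Reasoning
  bound : ∀ s → count s e p ≤ count (suc t) e p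
  bound s with ≤-total s (suc t)
  ... | inj₁ s≤t = increasing-mono (count-increasing e p) s≤t
  ... | inj₂ t<s = constant (≤⇒≤′ t<s)

-- The counter cannot pass a point `m` that is neither exempt nor ever seen, so it would be bounded
-- by `m`.
active⇒enumerates : ∀ {e p m} → Active e p → fst p ≤ fst m →
                    digit e (fst m) ≢ digit e (fst p) → ¬ ¬ Enumerated e m
active⇒enumerates {e} {p} {m} active p≤m differ ¬enum = active (m , bound)
  where
  stuck : ∀ s → advance s e p m ≡ 0
  stuck s = ifz-elim (_≡ 0) (unseen s e p) (λ _ → refl) λ _ →
    trans (ifz-≡0 (m≤n⇒m∸n≡0 p≤m))
    (trans (ifz-≢0 (differ ∘ dist≡0⇒≡ (digit e (fst m)) (digit e (fst p))))
      (ifz-≢0 (¬enum ∘ seen⇒enumerated s)))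
  bound : ∀ s → count s e p ≤ m
  bound zero    = z≤n
  bound (suc s) with m≤n⇒m<n∨m≡n (bound s)
  ... | inj₁ lt = begin
    count s e p + advance s e p (count s e p) ≤⟨ +-monoʳ-≤ _ (advance≤1 s e p _) ⟩
    count s e p + 1                           ≡⟨ +-comm _ 1 ⟩
    suc (count s e p)                         ≤⟨ lt ⟩
    m                                         ∎
    where open ≤-Reasoning
  ... | inj₂ eq rewrite eq | stuck s = ≤-reflexive (+-identityʳ m)

-- A bounded counter would come to rest at some `m`, but `m` is exempt or eventually seen, and then
-- the counter moves on.
enumerates⇒active : ∀ {e p} → ¬ Enumerated e p →
  (∀ m → fst p ≤ fst m → digit e (fst m) ≢ digit e (fst p) → ¬ ¬ Enumerated e m) →
  Active e p
enumerates⇒active {e} {p} ¬enum enumerates bounded =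
  bounded-stabilises {λ s → count s e p} (count-increasing e p) bounded λ (h , lim) →
    absurd (count h e p) h λ s h≤s advances → 1+n≢n (begin
      suc (count h e p)                          ≡⟨ +-comm 1 _ ⟩
      count h e p + 1                            ≡⟨ cong (count h e p +_) (sym advances) ⟩
      count h e p + advance s e p (count h e p)
        ≡⟨ cong (λ m → m + advance s e p m) (sym (lim s h≤s)) ⟩
      count (suc s) e p                          ≡⟨ lim (suc s) (m≤n⇒m≤1+n h≤s) ⟩
      count h e p                                ∎)
  where
  open ≡-Reasoning
  absurd : ∀ m h → (∀ s → h ≤ s → advance s e p m ≢ 1) → ⊥
  absurd m h stuck with fst p ≤? fst m | digit e (fst m) ≟ digit e (fst p)
  ... | no p≰m | _ =
    stuck h ≤-refl (trans (ifz-≢0 (¬enum ∘ seen⇒enumerated h)) (ifz-≢0 (p≰m ∘ m∸n≡0⇒m≤n)))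
  ... | yes p≤m | yes same =
    stuck h ≤-refl (trans (ifz-≢0 (¬enum ∘ seen⇒enumerated h))
      (trans (ifz-≡0 (m≤n⇒m∸n≡0 p≤m)) (ifz-≡0 (≡⇒dist≡0 same))))
  ... | yes p≤m | no differ = enumerates m p≤m differ λ (t , hit) →
    -- A stage past the limit at which `m` has been seen.
    let s = suc t ⊔ h in
    stuck s (m≤n⊔m (suc t) h) (trans (ifz-≢0 (¬enum ∘ seen⇒enumerated s))
      (trans (ifz-≡0 (m≤n⇒m∸n≡0 p≤m))
      (trans (ifz-≢0 (differ ∘ dist≡0⇒≡ (digit e (fst m)) (digit e (fst p))))
        (ifz-≡0 (seen hit (m≤m⊔n (suc t) h))))))

-- The point with the larger first component is not enumerated, so the other
-- requirement forces its digit.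
active-digits-agree : ∀ {e p q} → Active e p → Active e q →
                      digit e (fst p) ≡ digit e (fst q)
active-digits-agree {e} {p} {q} activeP activeQ with ≤-total (fst p) (fst q)
... | inj₁ p≤q = decidable-stable (_ ≟ _) λ neq →
  active⇒enumerates activeP p≤q (neq ∘ sym) (active⇒¬enumerated activeQ)
... | inj₂ q≤p = decidable-stable (_ ≟ _) λ neq →
  active⇒enumerates activeQ q≤p neq (active⇒¬enumerated activeP)

Avoids : (ℕ → ℕ) → ℕ → Set
Avoids π k =
  ∀ i → i < k → Active (fst i) (snd i) → π (fst i) ≢ digit (fst i) (fst (snd i))

1∸n≢n : ∀ n → 1 ∸ n ≢ n
1∸n≢n zero    ()
1∸n≢n (suc n) eq = 0≢1+n (trans (sym (0∸n≡0 n)) eq)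

-- Requirements are treated in turn, with one use of excluded middle for each. An active one sets
-- its digit to the opposite value.
avoiding-pattern : ∀ k → ¬ ¬ (∃[ π ] (∀ e → π e ≤ 1) × Avoids π k)
avoiding-pattern zero    none = none ((λ _ → 0) , (λ _ → z≤n) , λ i ())
avoiding-pattern (suc k) none = avoiding-pattern k λ (π , π≤1 , avoids) →
  ¬¬-excluded-middle λ
    { (no inactive) → none (π , π≤1 , keep-avoids {π} inactive avoids)
    ; (yes active)  → none (update π , update≤1 {π} π≤1 , update-avoids {π} active avoids) }
  where
  e = fst k
  v = 1 ∸ digit e (fst (snd k))

  update : (ℕ → ℕ) → ℕ → ℕ
  update π e′ with e′ ≟ e
  ... | yes _ = v
  ... | no  _ = π e′

  update≤1 : ∀ {π} → (∀ e → π e ≤ 1) → ∀ e′ → update π e′ ≤ 1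
  update≤1 π≤1 e′ with e′ ≟ e
  ... | yes _ = m∸n≤m 1 (digit e (fst (snd k)))
  ... | no  _ = π≤1 e′

  keep-avoids : ∀ {π} → ¬ Active (fst k) (snd k) → Avoids π k → Avoids π (suc k)
  keep-avoids inactive avoids i (s≤s i≤k) active with m≤n⇒m<n∨m≡n i≤k
  ... | inj₁ i<k  = avoids i i<k active
  ... | inj₂ refl = contradiction active inactive

  update-avoids : ∀ {π} → Active (fst k) (snd k) → Avoids π k → Avoids (update π) (suc k)
  update-avoids activeₖ avoids i (s≤s i≤k) active eq with fst i ≟ e
  -- Overwriting digit `e` does no harm to other active requirements on `e`, since they all name the
  -- same value.
  ... | yes same = 1∸n≢n _ (trans eq
    (trans (cong (λ d → digit d (fst (snd i))) same)
      (active-digits-agree (subst (λ d → Active d (snd i)) same active) activeₖ)))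
  ... | no  differ with m≤n⇒m<n∨m≡n i≤k
  ...   | inj₁ i<k  = avoids i i<k active eq
  ...   | inj₂ refl = differ refl

-- Infinitude of the set

weight-increasing : ∀ τ i → Increasing (λ s → weight τ s i)
weight-increasing τ i s with shift (suc i) τ | dist (bit (fst i) τ) (digit (fst i) (fst (snd i)))
... | zero  | _     = z≤n
... | suc _ | zero  = count-increasing (fst i) (snd i) s
... | suc _ | suc _ = z≤n

weights-increasing : ∀ n τ → Increasing (weights n τ)
weights-increasing zero    τ s = z≤n
weights-increasing (suc n) τ s = +-mono-≤ (weights-increasing n τ s) (weight-increasing τ n s)

total-increasing : ∀ τ → Increasing (total τ)
total-increasing τ = weights-increasing τ τ

weight≤weights : ∀ {n i} τ s → i < n → weight τ s i ≤ weights n τ s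
weight≤weights {suc n} τ s (s≤s i≤n) with m≤n⇒m<n∨m≡n i≤n
... | inj₁ i<n  = ≤-trans (weight≤weights τ s i<n) (m≤m+n _ _)
... | inj₂ refl = m≤n+m _ _

weights-bounded : ∀ τ → (∀ i → ¬ ¬ Bounded (λ s → weight τ s i)) →
                  ∀ n → ¬ ¬ Bounded (weights n τ)
weights-bounded τ bd zero    none = none (0 , λ s → z≤n)
weights-bounded τ bd (suc n) none =
  weights-bounded τ bd n λ (b , ≤b) → bd n λ (c , ≤c) →
    none (b + c , λ s → +-mono-≤ (≤b s) (≤c s))

settled : ∀ {τ h} → (∀ s → h ≤ s → total τ s ≡ total τ h) →
          (∀ s → s < h → total τ s ≢ total τ h) → Settled (pair τ h)
settled {τ} {h} lim early s rewrite fst-pair τ h | snd-pair τ h =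
  ifz-elim (_≡ 0) (suc s ∸ h)
    (λ s<h → ifz-≢0 (early s (m∸n≡0⇒m≤n s<h) ∘ dist≡0⇒≡ (total τ s) (total τ h)))
    (λ s≮h → ≡⇒dist≡0 (lim s (≮⇒≥ (s≮h ∘ m≤n⇒m∸n≡0))))

settled-late : ∀ {x s} → Settled x → snd x ≤ s → total (fst x) s ≡ total (fst x) (snd x)
settled-late {x} {s} set h≤s = dist≡0⇒≡ _ _
  (trans (sym (ifz-≢0 (λ ≡0 → <⇒≱ (s≤s h≤s) (m∸n≡0⇒m≤n ≡0)))) (set s))

settled-early : ∀ {x s} → Settled x → s < snd x → total (fst x) s ≢ total (fst x) (snd x)
settled-early {x} {s} set s<h eq = 1+n≢0 (trans (sym value) (set s))
  where
  value : check s x ≡ 1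
  value = trans (ifz-≡0 (m≤n⇒m∸n≡0 s<h))
    (ifz-≡0 (≡⇒dist≡0 eq))

-- Otherwise the total would have its final value at `snd y` already, before the exact stage
-- `snd x`. By symmetry, each pattern has at most one stage.
settled-snd≤ : ∀ {x y} → Settled x → Settled y → fst x ≡ fst y → snd x ≤ snd y
settled-snd≤ {x} {y} setx sety eq = ≮⇒≥ λ y<x →
  settled-early {x} setx y<x
    (sym (subst (λ τ → total τ (snd x) ≡ total τ (snd y)) (sym eq)
      (settled-late {y} sety (<⇒≤ y<x))))

-- For an avoiding pattern of length `k`, every weight is bounded: the requirement is beyond the
-- length, disagrees with the pattern or is not active. So the total has a limit, and its exact
-- stage gives a member above `k`.
Settled-infinite : Infinite Settled
Settled-infinite (k , none) = avoiding-pattern k λ (π , π≤1 , avoids) →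
  let τ = build π k
  in weights-bounded τ (weight-bounded π π≤1 avoids) τ λ bd →
     bounded-stabilises (total-increasing τ) bd λ (h , lim) →
     let (h′ , lim′ , early) = modulus (total-increasing τ) h lim
     in none (pair τ h′) (≤-trans (<⇒≤ (k<build π k)) (fst≤pair τ h′)) (settled lim′ early)
  where
  weight-bounded : ∀ π → (∀ e → π e ≤ 1) → Avoids π k →
                   ∀ i → ¬ ¬ Bounded (λ s → weight (build π k) s i)
  weight-bounded π π≤1 avoids i unbounded with shift (suc i) (build π k) ≟ 0
  ... | yes ≡0 = unbounded (0 , λ s → ≤-reflexive (ifz-≡0 ≡0))
  ... | no  ≢0 with dist (bit (fst i) (build π k)) (digit (fst i) (fst (snd i))) ≟ 0
  ...   | no  differ = unbounded (0 , λ s → ≤-reflexive (trans (ifz-≢0 ≢0) (ifz-≢0 differ)))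
  ...   | yes same   = avoids i i<k
    (λ (b , ≤b) → unbounded (b , λ s →
      ≤-trans (≤-reflexive (trans (ifz-≢0 ≢0) (ifz-≡0 same))) (≤b s)))
    -- The digit concerned is `fst i ≤ i < k`, hence one that `π` determines.
    (trans (sym (bit-build π π≤1 (≤-<-trans (fst≤ i) i<k))) (dist≡0⇒≡ _ _ same))
    where
    i<k : i < k
    i<k = shift-build≢0 π π≤1 i k ≢0

-- If the pattern reached beyond `pair e p`, the unbounded counter would be a summand of a total
-- that has a limit.
active⇒short : ∀ {e p x} → Active e p → Settled x → digit e x ≡ digit e (fst p) →
               fst x < 2 ^ suc (pair e p)
active⇒short {e} {p} {x} active set same with shift (suc (pair e p)) (fst x) ≟ 0
... | yes ≡0 = shift≡0⇒<2^ (suc (pair e p)) (fst x) ≡0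
... | no  ≢0 = contradiction (total τ h , bound) active
  where
  i = pair e p
  τ = fst x
  h = snd x
  weight≡count : ∀ s → weight τ s i ≡ count s e p
  weight≡count s = trans (ifz-≢0 ≢0) eq
    where
    eq : ifz (dist (bit (fst i) τ) (digit (fst i) (fst (snd i)))) (count s (fst i) (snd i)) 0
         ≡ count s e p
    eq rewrite fst-pair e p | snd-pair e p =
      ifz-≡0 (≡⇒dist≡0 same)
  bound : ∀ s → count s e p ≤ total τ h
  bound s = begin
    -- Stage `s + h` is past `s`, for monotonicity, and past `h`, where the total is final.
    count s e p          ≤⟨ increasing-mono (count-increasing e p) (m≤m+n s h) ⟩
    count (s + h) e p    ≡⟨ sym (weight≡count (s + h)) ⟩
    weight τ (s + h) i   ≤⟨ weight≤weights τ (s + h) (<-trans (n<1+n i) (shift≢0⇒< (suc i) τ ≢0)) ⟩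
    total τ (s + h)      ≡⟨ settled-late {x} set (m≤n+m h s) ⟩
    total τ h            ∎
    where open ≤-Reasoning

-- Excluded middle asks, for each pattern below `n`, whether it occurs; if so, its only stage joins
-- the maximum.
settled-snd-bounded : ∀ n → ¬ ¬ (∃[ b ] (∀ x → Settled x → fst x < n → snd x ≤ b))
settled-snd-bounded zero    none = none (0 , λ x _ ())
settled-snd-bounded (suc n) none = settled-snd-bounded n λ (b , ≤b) →
  ¬¬-excluded-middle {A = ∃[ y ] Settled y × fst y ≡ n} λ
  { (yes (y , sety , fst≡n)) → none (b ⊔ snd y , λ x setx x<1+n → cover b ≤b
      (λ x setx eq → settled-snd≤ {x} {y} setx sety (trans eq (sym fst≡n))) x setx x<1+n)
  -- No stage belongs to `n` here; 0 is a default.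
  ; (no ¬y) → none (b ⊔ 0 , λ x setx x<1+n → cover b ≤b
      (λ x setx eq → contradiction (x , setx , eq) ¬y) x setx x<1+n) }
  where
  cover : ∀ b {c} → (∀ x → Settled x → fst x < n → snd x ≤ b) →
          (∀ x → Settled x → fst x ≡ n → snd x ≤ c) →
          ∀ x → Settled x → fst x < suc n → snd x ≤ b ⊔ c
  cover b ≤b ≤c x setx (s≤s x≤n) with m≤n⇒m<n∨m≡n x≤n
  ... | inj₁ x<n = ≤-trans (≤b x setx x<n) (m≤m⊔n _ _)
  ... | inj₂ x≡n = ≤-trans (≤c x setx x≡n) (m≤n⊔m b _)

-- Programs for Σ₂ sets

-- `rejected` speaks of every number `p`, even outside the range of `pair`, because the counters
-- inspect all numbers and the machine reads only `fst p` and `snd p`.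
record Σ₂-program (C : Subset) : Set where
  field
    program    : ℕ
    accepted   : ∀ x → C x → ∃[ p ] fst p ≡ x × ¬ Enumerated program p
    rejected   : ∀ p → ¬ C (fst p) → ¬ ¬ Enumerated program p

-- The program decides the matrix `T`. Output 0 at some `z` refutes the universal quantifier, so the
-- enumerated pairs are those outside `S`.
Σ₂⇒program : ∀ {C} → Σ-set 2 C → Σ₂-program C
Σ₂⇒program {C} (exists S (forAll T (computable (f , char)) S⇔∀T) C⇔∃S) = record
  { program  = compile f
  ; accepted = λ x Cx → let (y , Sy) = Equivalence.to (C⇔∃S (x ∷ [])) Cx in
      pair x y , fst-pair x y ,
      in-S⇒¬enumerated (pair x y)
        (subst₂ (λ y x → S (y ∷ x ∷ [])) (sym (snd-pair x y)) (sym (fst-pair x y)) Sy)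
  ; rejected = λ p ¬Cp ¬enum → ¬Cp (Equivalence.from (C⇔∃S (fst p ∷ []))
      (snd p , Equivalence.from (S⇔∀T _) (¬enumerated⇒T p ¬enum)))
  }
  where
  start : ℕ → ℕ → ℕ
  start p z = config (compile f) 0 (encode (z ∷ snd p ∷ fst p ∷ []))

  in-S⇒¬enumerated : ∀ p → S (snd p ∷ fst p ∷ []) → ¬ Enumerated (compile f) p
  in-S⇒¬enumerated p Sp (t , hit) with char (fst t ∷ snd p ∷ fst p ∷ [])
  -- The same start would halt both with 1 and with 0.
  ... | inj₁ (_ , ⇓1) = 1+n≢0 (halt-unique {start p (fst t)}
    (compile-runs ⇓1 0) (snd t , trans hit (sym pair-0-0)))
  ... | inj₂ (¬T , _) = ¬T (Equivalence.to (S⇔∀T _) Sp (fst t))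

  ¬enumerated⇒T : ∀ p → ¬ Enumerated (compile f) p → ∀ z → T (z ∷ snd p ∷ fst p ∷ [])
  ¬enumerated⇒T p ¬enum z with char (z ∷ snd p ∷ fst p ∷ [])
  ... | inj₁ (Tz , _) = Tz
  ... | inj₂ (_ , ⇓0) with compile-runs ⇓0 0
  ...   | n , eq = contradiction (pair z n , hit) ¬enum
    where
    hit : member-run (compile f) p (pair z n) ≡ 0
    hit rewrite fst-pair z n | snd-pair z n = trans eq pair-0-0

-- The contradiction with p-cohesiveness

digits-stabilise : ∀ {C} e → PCohesive C →
                   ∃[ n ] (∀ x y → n ≤ x → n ≤ y → C x → C y → digit e x ≡ digit e y)
digits-stabilise e (_ , cohesive)
  with cohesive (λ x → digit e x ≡ 1) (digit-primitiveRecursive e)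
... | inj₁ (n , in-A) = n , λ x y n≤x n≤y Cx Cy →
  trans (one x n≤x Cx) (sym (one y n≤y Cy))
  where
  one : ∀ x → n ≤ x → _ → digit e x ≡ 1
  -- Almost inclusion refutes only the inequality; equality of digits is decidable.
  one x n≤x Cx = decidable-stable (_ ≟ _) λ neq → in-A x n≤x (Cx , neq)
... | inj₂ (n , in-∁A) = n , λ x y n≤x n≤y Cx Cy →
  trans (nought x n≤x Cx) (sym (nought y n≤y Cy))
  where
  nought : ∀ x → n ≤ x → _ → digit e x ≡ 0
  nought x n≤x Cx = n<1⇒n≡0 (≤∧≢⇒< (parity≤1 (shift e (fst x))) λ eq →
    in-∁A x n≤x (Cx , λ neq → neq eq))

-- A member `x₀` of `C` past the point where digit `e` is constant yields an active requirement. It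
-- makes all later members short, and short members are bounded.
no-Σ₂-cohesive-subset : ∀ {C} → C ⊆ Settled → Σ-set 2 C → ¬ PCohesive C
no-Σ₂-cohesive-subset {C} C⊆Settled Σ₂ cohesive =
  proj₁ cohesive (n , λ x₀ n≤x₀ Cx₀ →
    let (p , p≡x₀ , ¬enum) = accepted x₀ Cx₀
        agrees : ∀ x → n ≤ x → C x → digit e x ≡ digit e (fst p)
        agrees x n≤x Cx = trans (same x x₀ n≤x n≤x₀ Cx Cx₀) (cong (digit e) (sym p≡x₀))
        active : Active e p
        -- Past `n`, all of `C` has the digit of `x₀`, so a point `fst m` with another digit is
        -- outside `C`.
        active = enumerates⇒active ¬enum λ m p≤m differ → rejected m λ Cm →
          differ (agrees (fst m) (≤-trans n≤x₀ (≤-trans (≤-reflexive (sym p≡x₀)) p≤m)) Cm)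
        short : ∀ x → n ≤ x → C x → fst x < 2 ^ suc (pair e p)
        short x n≤x Cx = active⇒short {x = x} active (C⊆Settled Cx) (agrees x n≤x Cx)
    in settled-snd-bounded (2 ^ suc (pair e p)) λ (b , ≤b) →
       let c = pair (2 ^ suc (pair e p)) b in
       -- Infinitude is used a second time: a member past `n` has both components bounded, hence is
       -- at most `c`.
       proj₁ cohesive (n ⊔ suc c , λ x large Cx →
         let n≤x = ≤-trans (m≤m⊔n n (suc c)) large
             x-short = short x n≤x Cx
         in <-irrefl refl (<-≤-trans (≤-trans (m≤n⊔m n (suc c)) large)
              (≤-trans (≤pair-fst-snd x)
                (pair-mono (<⇒≤ x-short) (≤b x (C⊆Settled Cx) x-short))))))
  where
  open Σ₂-program (Σ₂⇒program {C} Σ₂) renaming (program to e)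
  n = proj₁ (digits-stabilise e cohesive)
  same = proj₂ (digits-stabilise e cohesive)

corollary3p6 : ∃[ A ] Π-set 1 A × Infinite A × ¬ (∃[ C ] C ⊆ A × Δ-set 2 C × PCohesive C)
corollary3p6 = Settled , Settled-Π₁ , Settled-infinite ,
  λ (C , C⊆A , (Σ₂ , _) , cohesive) → no-Σ₂-cohesive-subset C⊆A Σ₂ cohesive
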